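{- Let $Q,R,S\in\mathfrak{P}$ with $Q\cap R=\emptyset$ and $Q\cap S=\emptyset$. If $Q+R\sqsubseteq_I Q+S$, then $R\sqsubseteq_I S$.
   Context: $\mathfrak{P}$ is the class of finite nonempty posets and $\mathfrak{P}_r$ a fixed system of representatives of its isomorphism classes. $\mathcal{H}(P,Q)$ is the set of order-preserving maps $P\to Q$. $A+B$ denotes the direct sum (disjoint union without comparabilities between the summands). For $A\subseteq P$, $x\in A$: $\gamma_A(x)$ is the set of $y\in A$ joined to $x$ by a sequence $x=z_0,\dots,z_L=y$ in $A$ ($L\ge0$) with consecutive elements strictly comparable. For a map $\xi$ on $P$, $G_\xi(x):=\gamma_{\xi^{ -1}(\xi(x))}(x)$. For $A\subseteq P$, ${\downarrow^{\circ}}A:=\{y\in P: y\le a\text{ for some }a\in A\}\setminus A$ and ${\uparrow_{\circ}}A:=\{y\in P: y\ge a\text{ for some }a\in A\}\setminus A$. The EV-system $\mathcal{E}(P)$ is the set of triples $(x,D,U)$ with $x\in P$, $D\subseteq{\downarrow^{\circ}}\{x\}$, $U\subseteq{\uparrow_{\circ}}\{x\}$; on it, $\mathfrak a<_+\mathfrak b$ iff $\mathfrak a_1\in\mathfrak b_2$ and $\mathfrak b_1\in\mathfrak a_3$, and $\le_+$ is $<_+$ together with equality. For $\xi\in\mathcal{H}(P,Q)$ and $x\in P$, $\alpha_{P,\xi}(x):=(\xi(x),\xi({\downarrow^{\circ}}G_\xi(x)),\xi({\uparrow_{\circ}}G_\xi(x)))\in\mathcal{E}(Q)$. For $R,S\in\mathfrak{P}$,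 a Hom-scheme from $R$ to $S$ is a family $\rho=(\rho_P)_{P\in\mathfrak{P}_r}$ of maps $\rho_P:\mathcal{H}(P,R)\to\mathcal{H}(P,S)$; it is strong if every $\rho_P$ is injective; it is an I-scheme if for all $P,P'\in\mathfrak{P}_r$, $\xi\in\mathcal{H}(P,R)$, $\zeta\in\mathcal{H}(P',R)$, $x\in P$, $y\in P'$: $\alpha_{P,\xi}(x)\le_+\alpha_{P',\zeta}(y)$ implies $\alpha_{P,\rho_P(\xi)}(x)\le_+\alpha_{P',\rho_{P'}(\zeta)}(y)$, where $<_+$ on the left implies $<_+$ on the right. $R\sqsubseteq_I S$ means that a strong I-scheme from $R$ to $S$ exists. -}

module Defs where

open import Level using (0ℓ)
open import Data.Nat using (ℕ; _+_)
open import Data.Fin using (Fin)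
open import Data.Fin.Properties using (+↔⊎)
open import Data.Sum using (_⊎_; inj₁; inj₂)
open import Data.Sum.Function.Propositional using (_⊎-↔_)
open import Data.Product using (Σ; _×_; _,_; ∃; ∃-syntax)
open import Function.Bundles using (_↔_; Inverse)
open import Function.Properties.Inverse using (↔-trans)
open import Relation.Binary.PropositionalEquality using (_≡_; _≢_; refl; cong)
open import Relation.Nullary using (¬_)
open import Relation.Unary using (Pred; _∈_; _⊆_)

record FPoset : Set₁ where
  field
    Carrier : Set
    _≤_     : Carrier → Carrier → Set
    ≤-refl  : ∀ {x} → x ≤ x
    ≤-trans : ∀ {x y z} → x ≤ y → y ≤ z → x ≤ z
    ≤-antisym : ∀ {x y} → x ≤ y → y ≤ x → x ≡ y
    size    : ℕ
    enum    : Fin size ↔ Carrier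
    point   : Carrier

open FPoset public

record _≅_ (P Q : FPoset) : Set where
  field
    bij     : Carrier P ↔ Carrier Q
    mono    : ∀ {x y} → _≤_ P x y → _≤_ Q (Inverse.to bij x) (Inverse.to bij y)
    reflect : ∀ {x y} → _≤_ Q (Inverse.to bij x) (Inverse.to bij y) → _≤_ P x y

record IsRepSystem {Ix : Set} (Rep : Ix → FPoset) : Set₁ where
  field
    covers : ∀ (P : FPoset) → ∃[ i ] (P ≅ Rep i)
    unique : ∀ i j → Rep i ≅ Rep j → i ≡ j

data SumLe (A B : FPoset) : Carrier A ⊎ Carrier B → Carrier A ⊎ Carrier B → Set where
  inl : ∀ {x y} → _≤_ A x y → SumLe A B (inj₁ x) (inj₁ y)
  inr : ∀ {x y} → _≤_ B x y → SumLe A B (inj₂ x) (inj₂ y)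

_⊕_ : FPoset → FPoset → FPoset
A ⊕ B = record
  { Carrier = Carrier A ⊎ Carrier B
  ; _≤_ = SumLe A B
  ; ≤-refl = rfl
  ; ≤-trans = trn
  ; ≤-antisym = asym
  ; size = size A + size B
  ; enum = ↔-trans +↔⊎ (enum A ⊎-↔ enum B)
  ; point = inj₁ (point A)
  }
  where
  rfl : ∀ {x} → SumLe A B x x
  rfl {inj₁ x} = inl (≤-refl A)
  rfl {inj₂ x} = inr (≤-refl B)
  trn : ∀ {x y z} → SumLe A B x y → SumLe A B y z → SumLe A B x z
  trn (inl p) (inl q) = inl (≤-trans A p q)
  trn (inr p) (inr q) = inr (≤-trans B p q)
  asym : ∀ {x y} → SumLe A B x y → SumLe A B y x → x ≡ y
  asym (inl p) (inl q) = cong inj₁ (≤-antisym A p q)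
  asym (inr p) (inr q) = cong inj₂ (≤-antisym B p q)

record Hom (P Q : FPoset) : Set where
  constructor mkHom
  field
    fun  : Carrier P → Carrier Q
    mono : ∀ {x y} → _≤_ P x y → _≤_ Q (fun x) (fun y)

open Hom public

_≗H_ : ∀ {P Q} → Hom P Q → Hom P Q → Set
f ≗H g = ∀ x → fun f x ≡ fun g x

module _ (P : FPoset) where
  StrictComp : Carrier P → Carrier P → Set
  StrictComp x y = (_≤_ P x y × x ≢ y) ⊎ (_≤_ P y x × x ≢ y)

  data Path (A : Pred (Carrier P) 0ℓ) (x : Carrier P) : Carrier P → Set where
    start : Path A x x
    step  : ∀ {z y} → Path A x z → y ∈ A → StrictComp z y → Path A x y

  γ : Pred (Carrier P) 0ℓ → Carrier P → Pred (Carrier P) 0ℓ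
  γ A x y = x ∈ A × y ∈ A × Path A x y

  ↓° : Pred (Carrier P) 0ℓ → Pred (Carrier P) 0ℓ
  ↓° A y = (∃[ a ] (a ∈ A × _≤_ P y a)) × ¬ (y ∈ A)

  ↑° : Pred (Carrier P) 0ℓ → Pred (Carrier P) 0ℓ
  ↑° A y = (∃[ a ] (a ∈ A × _≤_ P a y)) × ¬ (y ∈ A)

image : {X Y : Set} → (X → Y) → Pred X 0ℓ → Pred Y 0ℓ
image f A y = ∃[ a ] (a ∈ A × f a ≡ y)

G : ∀ {P Q} → Hom P Q → Carrier P → Pred (Carrier P) 0ℓ
G {P} ξ x = γ P (λ z → fun ξ z ≡ fun ξ x) x

record EV (Q : FPoset) : Set₁ where
  constructor ev
  field
    pt : Carrier Q
    D  : Pred (Carrier Q) 0ℓ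
    U  : Pred (Carrier Q) 0ℓ

open EV public

IsInEV : ∀ {Q} → EV Q → Set
IsInEV {Q} e = (D e ⊆ ↓° Q (_≡ pt e)) × (U e ⊆ ↑° Q (_≡ pt e))

_≐_ : {X : Set} → Pred X 0ℓ → Pred X 0ℓ → Set
A ≐ B = (A ⊆ B) × (B ⊆ A)

_≡EV_ : ∀ {Q} → EV Q → EV Q → Set
a ≡EV b = (pt a ≡ pt b) × (D a ≐ D b) × (U a ≐ U b)

_<₊_ : ∀ {Q} → EV Q → EV Q → Set
a <₊ b = (pt a ∈ D b) × (pt b ∈ U a)

_≤₊_ : ∀ {Q} → EV Q → EV Q → Set
a ≤₊ b = (a <₊ b) ⊎ (a ≡EV b)

α : ∀ {P Q} → Hom P Q → Carrier P → EV Q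
α {P} ξ x = ev (fun ξ x) (image (fun ξ) (↓° P (G ξ x))) (image (fun ξ) (↑° P (G ξ x)))

module _ {Ix : Set} (Rep : Ix → FPoset) where

  record HomScheme (R S : FPoset) : Set where
    field
      ρ    : ∀ i → Hom (Rep i) R → Hom (Rep i) S
      -- ρ_P is a map of sets ℋ(P,R) → ℋ(P,S): respects equality of maps
      ρ-cong : ∀ i {ξ ζ} → ξ ≗H ζ → ρ i ξ ≗H ρ i ζ

  open HomScheme public

  IsStrong : ∀ {R S} → HomScheme R S → Set
  IsStrong σ = ∀ i {ξ ζ} → ρ σ i ξ ≗H ρ σ i ζ → ξ ≗H ζ

  IsIScheme : ∀ {R S} → HomScheme R S → Set
  IsIScheme σ =
    ∀ i j (ξ : Hom (Rep i) _) (ζ : Hom (Rep j) _) x y →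
      (α ξ x ≤₊ α ζ y → α (ρ σ i ξ) x ≤₊ α (ρ σ j ζ) y)
      × (α ξ x <₊ α ζ y → α (ρ σ i ξ) x <₊ α (ρ σ j ζ) y)

  _⊑I_ : FPoset → FPoset → Set
  R ⊑I S = Σ (HomScheme R S) (λ σ → IsStrong σ × IsIScheme σ)

{-# OPTIONS --safe #-}

-- Iterate ρ as one does to cancel a finite set from a bijection: starting from a map into R,
-- apply ρ and, as long as a connected component lands in Q, feed the result back in.  Being an
-- I-scheme makes ρ act on each component separately, so components may stop at different times;
-- since ρ is injective and there are finitely many maps, no component can stay in Q forever.
-- To avoid deciding connectedness, components are replaced by decidable subsets that are closed
-- under comparability (clopen).

module Submission where

open import Defs
open import Level using (0ℓ)
open import Data.Nat using (ℕ; zero; suc; _+_; _^_; _≤′_; ≤′-refl; ≤′-step)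
  renaming (_≤_ to _≤ℕ_)
import Data.Nat.Properties as ℕ
open import Data.Fin using (Fin; toℕ; funToFin; finToFun)
open import Data.Fin.Properties using (pigeonhole; finToFun-funToFin; toℕ≤pred[n])
open import Data.Sum using (_⊎_; inj₁; inj₂)
open import Data.Sum.Properties using (inj₁-injective; inj₂-injective)
open import Data.Product using (_×_; _,_; ∃-syntax; proj₁; proj₂)
open import Data.Unit using (⊤; tt)
open import Function using (id; _∘_; flip)
open import Function.Bundles using (Inverse)
open import Relation.Binary.PropositionalEquality
  using (_≡_; refl; sym; trans; cong; subst; module ≡-Reasoning)
open import Relation.Nullary using (¬_; Dec; yes; no; contradiction)
open import Relation.Nullary.Decidable using (_×-dec_; ¬?)
open import Relation.Unary using (Pred; Decidable; _⊆_; _∩_; ∁) renaming (U to Full)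

-- Clopen sets and gluing of maps along them.

Clopen : (P : FPoset) → Pred (Carrier P) 0ℓ → Set
Clopen P A = ∀ {x y} → _≤_ P x y → (A x → A y) × (A y → A x)

module _ {P : FPoset} where

  ∩-clopen : ∀ {A B} → Clopen P A → Clopen P B → Clopen P (A ∩ B)
  ∩-clopen cA cB x≤y =
    (λ (a , b) → proj₁ (cA x≤y) a , proj₁ (cB x≤y) b) ,
    (λ (a , b) → proj₂ (cA x≤y) a , proj₂ (cB x≤y) b)

  ∁-clopen : ∀ {A} → Clopen P A → Clopen P (∁ A)
  ∁-clopen cA x≤y = (_∘ proj₂ (cA x≤y)) , (_∘ proj₁ (cA x≤y))

  full-clopen : Clopen P Full
  full-clopen _ = id , id

  path-stays : ∀ {A B x y} → Clopen P A → A x → Path P B x y → A y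
  path-stays cA x∈A start = x∈A
  path-stays cA x∈A (step p _ (inj₁ (z≤y , _))) = proj₁ (cA z≤y) (path-stays cA x∈A p)
  path-stays cA x∈A (step p _ (inj₂ (y≤z , _))) = proj₂ (cA y≤z) (path-stays cA x∈A p)

  -- Gluing along a clopen set is monotone because no comparable pair crosses its border.
  mix : ∀ {X A} → Decidable A → Clopen P A → Hom P X → Hom P X → Hom P X
  mix {X} {A} A? cA h h′ = mkHom val val-mono
    where
    val : Carrier P → Carrier X
    val x with A? x
    ... | yes _ = fun h x
    ... | no  _ = fun h′ x
    val-mono : ∀ {x y} → _≤_ P x y → _≤_ X (val x) (val y)
    val-mono {x} {y} x≤y with A? x | A? y
    ... | yes _   | yes _   = mono h x≤y
    ... | no  _   | no  _   = mono h′ x≤y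
    ... | yes x∈A | no  y∉A = contradiction (proj₁ (cA x≤y) x∈A) y∉A
    ... | no  x∉A | yes y∈A = contradiction (proj₂ (cA x≤y) y∈A) x∉A

  module _ {X A} (A? : Decidable A) (cA : Clopen P A) (h h′ : Hom P X) where

    mix-inside : ∀ {x} → A x → fun (mix A? cA h h′) x ≡ fun h x
    mix-inside {x} x∈A with A? x
    ... | yes _   = refl
    ... | no  x∉A = contradiction x∈A x∉A

    mix-outside : ∀ {x} → ¬ A x → fun (mix A? cA h h′) x ≡ fun h′ x
    mix-outside {x} x∉A with A? x
    ... | yes x∈A = contradiction x∈A x∉A
    ... | no  _   = refl

-- Transport of EV triples

-- A partial bijection, kept as a relation so that one transport argument serves three cases:
-- equality, the summand `Q` shared by `Q ⊕ R` and `Q ⊕ S`, and a right summand seen inside its sum.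
record Matching (X Y : Set) : Set₁ where
  field
    _~_        : X → Y → Set
    functional : ∀ {u v v′} → u ~ v → u ~ v′ → v ≡ v′
    injective  : ∀ {u u′ v} → u ~ v → u′ ~ v → u ≡ u′

converse : ∀ {X Y} → Matching X Y → Matching Y X
converse M = record
  { _~_ = flip _~_ ; functional = injective ; injective = functional }
  where open Matching M

≡-matching : ∀ {X} → Matching X X
≡-matching = record
  { _~_ = _≡_
  ; functional = λ { refl refl → refl }
  ; injective  = λ { refl refl → refl }
  }

inj₁-matching : ∀ {X Y Z : Set} → Matching (X ⊎ Y) (X ⊎ Z)
inj₁-matching = record
  { _~_ = λ u v → ∃[ x ] (u ≡ inj₁ x × v ≡ inj₁ x)
  ; functional = λ { (_ , refl , refl) (_ , refl , refl) → refl }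
  ; injective  = λ { (_ , refl , refl) (_ , refl , refl) → refl }
  }

inj₂-matching : ∀ {X Y : Set} → Matching (X ⊎ Y) Y
inj₂-matching = record
  { _~_ = λ u v → u ≡ inj₂ v
  ; functional = λ { refl refl → refl }
  ; injective  = λ { refl refl → refl }
  }

-- The triple `α h x` depends only on `h` along the connected component of `x`, so matching values
-- are demanded only on some clopen set around `x`.
record MatchNear {P X Y : FPoset} (M : Matching (Carrier X) (Carrier Y))
                 (h : Hom P X) (h′ : Hom P Y) (x : Carrier P) : Set₁ where
  open Matching M
  field
    near   : Pred (Carrier P) 0ℓ
    clopen : Clopen P near
    here   : near x
    match  : ∀ {z} → near z → fun h z ~ fun h′ z

matchNear-converse : ∀ {P X Y} {M : Matching (Carrier X) (Carrier Y)}
  {h : Hom P X} {h′ : Hom P Y} {x} → MatchNear M h h′ x → MatchNear (converse M) h′ h x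
matchNear-converse m = record { MatchNear m }

match-everywhere : ∀ {P X Y} (M : Matching (Carrier X) (Carrier Y))
  {h : Hom P X} {h′ : Hom P Y} {x} → (∀ z → Matching._~_ M (fun h z) (fun h′ z)) →
  MatchNear M h h′ x
match-everywhere {P} M h~h′ = record
  { near = Full ; clopen = full-clopen {P} ; here = tt ; match = λ {z} _ → h~h′ z }

module _ {P X Y : FPoset} {M : Matching (Carrier X) (Carrier Y)}
         {h : Hom P X} {h′ : Hom P Y} {x : Carrier P} where
  open Matching M

  -- Paths from `x` never leave `near`, and there equal values of `h` have equal partners. Used also
  -- for the converse matching, this shows that both maps have the same `G` at `x`.
  G-match : MatchNear M h h′ x → G h x ⊆ G h′ x
  G-match m {y} (_ , hy≡hx , p) = refl , value (path-stays {P} clopen here p) hy≡hx , path p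
    where
    open MatchNear m
    value : ∀ {z} → near z → fun h z ≡ fun h x → fun h′ z ≡ fun h′ x
    value z∈ eq = functional (match z∈) (subst (_~ fun h′ x) (sym eq) (match here))
    path : ∀ {z} → Path P (λ w → fun h w ≡ fun h x) x z → Path P (λ w → fun h′ w ≡ fun h′ x) x z
    path start = start
    path p@(step q eq sc) = step (path q) (value (path-stays {P} clopen here p) eq) sc

module _ {P X Y : FPoset} {M : Matching (Carrier X) (Carrier Y)}
         {h : Hom P X} {h′ : Hom P Y} {x : Carrier P} (m : MatchNear M h h′ x) where
  open MatchNear m

  ↓°-match : ↓° P (G h x) ⊆ ↓° P (G h′ x)
  ↓°-match ((a , a∈G , y≤a) , y∉G) =
    -- Staying outside `G` requires the opposite inclusion, hence the converse matching.
    (a , G-match m a∈G , y≤a) , λ y∈G → y∉G (G-match (matchNear-converse m) y∈G)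

  ↑°-match : ↑° P (G h x) ⊆ ↑° P (G h′ x)
  ↑°-match ((a , a∈G , a≤y) , y∉G) =
    (a , G-match m a∈G , a≤y) , λ y∈G → y∉G (G-match (matchNear-converse m) y∈G)

  ↓°-near : ↓° P (G h x) ⊆ near
  ↓°-near ((a , (_ , _ , p) , y≤a) , _) = proj₂ (clopen y≤a) (path-stays {P} clopen here p)

  ↑°-near : ↑° P (G h x) ⊆ near
  ↑°-near ((a , (_ , _ , p) , a≤y) , _) = proj₁ (clopen a≤y) (path-stays {P} clopen here p)

  open Matching M

  D-match : ∀ {u v} → u ~ v → D (α h x) u → D (α h′ x) v
  D-match u~v (z , z∈ , refl) = z , ↓°-match z∈ , functional (match (↓°-near z∈)) u~v

  U-match : ∀ {u v} → u ~ v → U (α h x) u → U (α h′ x) v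
  U-match u~v (z , z∈ , refl) = z , ↑°-match z∈ , functional (match (↑°-near z∈)) u~v

-- An I-scheme must preserve both `≤₊` and `<₊`; a tag lets one argument treat the two.
data Kind : Set where
  strict weak : Kind

_≤⟨_⟩_ : ∀ {X} → EV X → Kind → EV X → Set
a ≤⟨ strict ⟩ b = a <₊ b
a ≤⟨ weak   ⟩ b = a ≤₊ b

≤⟨⟩⇒≤₊ : ∀ {X} κ {a b : EV X} → a ≤⟨ κ ⟩ b → a ≤₊ b
≤⟨⟩⇒≤₊ strict = inj₁
≤⟨⟩⇒≤₊ weak   = id

≡EV-sym : ∀ {X} {a b : EV X} → a ≡EV b → b ≡EV a
≡EV-sym (p , (d , d′) , (u , u′)) = sym p , (d′ , d) , (u′ , u)

module _ {P P′ X Y : FPoset} {M : Matching (Carrier X) (Carrier Y)}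
         {h : Hom P X} {h′ : Hom P Y} {k : Hom P′ X} {k′ : Hom P′ Y} {x y}
         (m : MatchNear M h h′ x) (n : MatchNear M k k′ y) where
  open Matching M
  open MatchNear

  -- An element of `D (α h′ x)` is a value of `h′` on `near`, so it has a partner in `X`; the given
  -- inclusion applies to that partner, and `n` carries the outcome back to `Y`.
  D-⊆-match : D (α h x) ⊆ D (α k y) → D (α h′ x) ⊆ D (α k′ y)
  D-⊆-match D⊆D (z , z∈ , refl) = D-match n (match m (↓°-near m z∈ᴹ)) (D⊆D (z , z∈ᴹ , refl))
    where z∈ᴹ = ↓°-match (matchNear-converse m) z∈

  U-⊆-match : U (α h x) ⊆ U (α k y) → U (α h′ x) ⊆ U (α k′ y)
  U-⊆-match U⊆U (z , z∈ , refl) = U-match n (match m (↑°-near m z∈ᴹ)) (U⊆U (z , z∈ᴹ , refl))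
    where z∈ᴹ = ↑°-match (matchNear-converse m) z∈

module _ {P P′ X Y : FPoset} {M : Matching (Carrier X) (Carrier Y)}
         {h : Hom P X} {h′ : Hom P Y} {k : Hom P′ X} {k′ : Hom P′ Y} {x y}
         (m : MatchNear M h h′ x) (n : MatchNear M k k′ y) where
  open Matching M
  open MatchNear

  <₊-match : α h x <₊ α k y → α h′ x <₊ α k′ y
  <₊-match (x∈D , y∈U) = D-match n (match m (here m)) x∈D , U-match m (match n (here n)) y∈U

  ≡EV-match : α h x ≡EV α k y → α h′ x ≡EV α k′ y
  ≡EV-match (hx≡ky , (D⊆ , D⊇) , (U⊆ , U⊇)) =
    functional (match m (here m)) (subst (_~ fun k′ y) (sym hx≡ky) (match n (here n))) ,
    -- The reverse inclusions exchange `m` and `n`, so the inclusion lemmas must have both as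
    -- parameters that can still vary.
    (D-⊆-match m n D⊆ , D-⊆-match n m D⊇) ,
    (U-⊆-match m n U⊆ , U-⊆-match n m U⊇)

  ≤⟨⟩-match : ∀ κ → α h x ≤⟨ κ ⟩ α k y → α h′ x ≤⟨ κ ⟩ α k′ y
  ≤⟨⟩-match strict p        = <₊-match p
  ≤⟨⟩-match weak   (inj₁ p) = inj₁ (<₊-match p)
  ≤⟨⟩-match weak   (inj₂ p) = inj₂ (≡EV-match p)

D-below : ∀ {P Q} (ξ : Hom P Q) {x u} → D (α ξ x) u → _≤_ Q u (fun ξ x)
D-below {Q = Q} ξ (z , ((a , (_ , ξa≡ξx , _) , z≤a) , _) , refl) =
  subst (_≤_ Q (fun ξ z)) ξa≡ξx (mono ξ z≤a)

module _ {P P′ Q : FPoset} {ξ : Hom P Q} {ζ : Hom P′ Q} {x : Carrier P} {y : Carrier P′} where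

  -- Brings the order of `Q` into play: antisymmetry then yields equal values, and in a direct sum
  -- comparable values lie in the same summand.
  ≤₊⇒≤ : α ξ x ≤₊ α ζ y → _≤_ Q (fun ξ x) (fun ζ y)
  ≤₊⇒≤ (inj₁ (x∈D , _)) = D-below ζ x∈D
  ≤₊⇒≤ (inj₂ (ξx≡ζy , _)) = subst (_≤_ Q (fun ξ x)) ξx≡ζy (≤-refl Q)

-- Iterating a map that respects components

Left : ∀ {X Y : Set} → Pred (X ⊎ Y) 0ℓ
Left u = ∃[ x ] u ≡ inj₁ x

left? : ∀ {X Y : Set} → Decidable (Left {X} {Y})
left? (inj₁ x) = yes (x , refl)
left? (inj₂ y) = no λ ()

¬left⇒inj₂ : ∀ {X Y : Set} {u : X ⊎ Y} → ¬ Left u → ∃[ y ] u ≡ inj₂ y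
¬left⇒inj₂ {u = inj₁ x} ¬l = contradiction (x , refl) ¬l
¬left⇒inj₂ {u = inj₂ y} ¬l = y , refl

left-clopen : ∀ {X Y} → Clopen (X ⊕ Y) Left
left-clopen (inl _) = (λ _ → _ , refl) , (λ _ → _ , refl)
left-clopen (inr _) = (λ ()) , (λ ())

inj₂-reflects-≤ : ∀ {X Y u v s t} → u ≡ inj₂ s → v ≡ inj₂ t → SumLe X Y u v → _≤_ Y s t
inj₂-reflects-≤ refl refl (inr s≤t) = s≤t

module Iteration (P Q R S : FPoset)
  (ρ : Hom P (Q ⊕ R) → Hom P (Q ⊕ S))
  (local : ∀ {A} → Clopen P A → ∀ {η θ} → (∀ {x} → A x → fun η x ≡ fun θ x) →
           ∀ {x} → A x → fun (ρ η) x ≡ fun (ρ θ) x)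
  (strong : ∀ {η θ} → ρ η ≗H ρ θ → η ≗H θ)
  where

  -- Glue `η` on `A` to `θ` elsewhere. By locality on `A` and on its complement, `ρ` sends the glued
  -- map and `θ` to the same map, so global injectivity applies.
  locally-injective : ∀ {A} → Decidable A → Clopen P A → ∀ {η θ} →
    (∀ {x} → A x → fun (ρ η) x ≡ fun (ρ θ) x) → ∀ {x} → A x → fun η x ≡ fun θ x
  locally-injective A? cA {η} {θ} eq {x} x∈A =
    trans (sym (mix-inside {P} {Q ⊕ R} A? cA η θ x∈A)) (strong ρμ≗ρθ x)
    where
    μ = mix {P} {Q ⊕ R} A? cA η θ
    ρμ≗ρθ : ρ μ ≗H ρ θ
    ρμ≗ρθ z with A? z
    ... | yes z∈A = trans (local cA {μ} {η} (mix-inside {P} {Q ⊕ R} A? cA η θ) z∈A) (eq z∈A)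
    ... | no  z∉A = local (∁-clopen {P} cA) {μ} {θ} (mix-outside {P} {Q ⊕ R} A? cA η θ) z∉A

  select : Carrier (Q ⊕ S) → Carrier (Q ⊕ R) → Carrier (Q ⊕ R)
  select (inj₁ q) _ = inj₁ q
  select (inj₂ _) v = v

  select-left : ∀ {u v q} → u ≡ inj₁ q → select u v ≡ inj₁ q
  select-left refl = refl

  select-frozen : ∀ {u v} → ¬ Left u → select u v ≡ v
  select-frozen {inj₁ q} ¬l = contradiction (q , refl) ¬l
  select-frozen {inj₂ _} _  = refl

  -- Comparable `u` and `u′` lie in the same summand, so both selections follow the same branch.
  select-mono : ∀ {u u′ v v′} → SumLe Q S u u′ → SumLe Q R v v′ →
    SumLe Q R (select u v) (select u′ v′)
  select-mono (inl q≤q′) _    = inl q≤q′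
  select-mono (inr _)    v≤v′ = v≤v′

  -- A component that has reached S keeps the last map into Q ⊕ R that it had before.
  advance : Hom P (Q ⊕ R) → Hom P (Q ⊕ R)
  advance η = mkHom (λ x → select (fun (ρ η) x) (fun η x))
                    (λ x≤y → select-mono (mono (ρ η) x≤y) (mono η x≤y))

  embed : Hom P R → Hom P (Q ⊕ R)
  embed ξ = mkHom (λ x → inj₂ (fun ξ x)) (λ x≤y → inr (mono ξ x≤y))

  orbit : Hom P R → ℕ → Hom P (Q ⊕ R)
  orbit ξ zero    = embed ξ
  orbit ξ (suc k) = advance (orbit ξ k)

  value : Hom P R → ℕ → Carrier P → Carrier (Q ⊕ S)
  value ξ k = fun (ρ (orbit ξ k))

  inQ : Hom P R → ℕ → Pred (Carrier P) 0ℓ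
  inQ ξ k x = Left (value ξ k x)

  inQ-clopen : ∀ ξ k → Clopen P (inQ ξ k)
  inQ-clopen ξ k x≤y = left-clopen (mono (ρ (orbit ξ k)) x≤y)

  frozen : ∀ ξ k {x} → ¬ inQ ξ k x → fun (orbit ξ (suc k)) x ≡ fun (orbit ξ k) x
  frozen ξ k = select-frozen

  value-frozen : ∀ ξ k {x} → ¬ inQ ξ k x → value ξ (suc k) x ≡ value ξ k x
  value-frozen ξ k = 
    local (∁-clopen {P} (inQ-clopen ξ k)) {orbit ξ (suc k)} {orbit ξ k} (frozen ξ k)

  inQ-pred : ∀ ξ k {x} → inQ ξ (suc k) x → inQ ξ k x
  inQ-pred ξ k {x} l with left? (value ξ k x)
  ... | yes l′ = l′
  ... | no  ¬l = contradiction (subst Left (value-frozen ξ k ¬l) l) ¬l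

  -- The values at all stages before `k` lie in `Q`; by `inQ-pred` it suffices to test the last of
  -- them. At stage 0 the condition is void.
  Active : Hom P R → ℕ → Pred (Carrier P) 0ℓ
  Active ξ zero    _ = ⊤
  Active ξ (suc k) = inQ ξ k

  active? : ∀ ξ k → Decidable (Active ξ k)
  active? ξ zero    _ = yes tt
  active? ξ (suc k) x = left? (value ξ k x)

  active-clopen : ∀ ξ k → Clopen P (Active ξ k)
  active-clopen ξ zero    _ = id , id
  active-clopen ξ (suc k) = inQ-clopen ξ k

  active-pred : ∀ ξ k {x} → Active ξ (suc k) x → Active ξ k x
  active-pred ξ zero    _ = tt
  active-pred ξ (suc k) = inQ-pred ξ k

  active-anti : ∀ ξ {k l} → k ≤ℕ l → Active ξ l ⊆ Active ξ k
  active-anti ξ k≤l = go (ℕ.≤⇒≤′ k≤l)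
    where
    go : ∀ {k l} → k ≤′ l → Active ξ l ⊆ Active ξ k
    go ≤′-refl        = id
    go (≤′-step {l} p) = go p ∘ active-pred ξ l

  -- Injectivity of ρ lets one walk two meeting orbits back in lockstep; if their lengths
  -- differed, one would reach its start in R while the other is still in Q.
  backtrack : ∀ {A} → Decidable A → Clopen P A → ∀ ξ ζ a b →
    A ⊆ Active ξ a → A ⊆ Active ζ b →
    (∀ {x} → A x → fun (orbit ξ a) x ≡ fun (orbit ζ b) x) →
    ∀ {x} → A x → a ≡ b × fun ξ x ≡ fun ζ x
  backtrack A? cA ξ ζ zero    zero    _  _  eq x∈A = refl , inj₂-injective (eq x∈A)
  backtrack A? cA ξ ζ zero    (suc b) _  tb eq x∈A
    with () ← trans (eq x∈A) (select-left (proj₂ (tb x∈A)))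
  backtrack A? cA ξ ζ (suc a) zero    ta _  eq x∈A
    with () ← trans (sym (select-left (proj₂ (ta x∈A)))) (eq x∈A)
  backtrack {A} A? cA ξ ζ (suc a) (suc b) ta tb eq x∈A =
    let a≡b , eq₀ = backtrack A? cA ξ ζ a b (active-pred ξ a ∘ ta) (active-pred ζ b ∘ tb)
                      (locally-injective A? cA {orbit ξ a} {orbit ζ b} values) x∈A
    in cong suc a≡b , eq₀
    where
    values : ∀ {x} → A x → value ξ a x ≡ value ζ b x
    values x∈A with ta x∈A | tb x∈A
    ... | q , ρξ | r , ρζ =
      trans ρξ (trans (cong inj₁ (inj₁-injective
        (trans (sym (select-left ρξ)) (trans (eq x∈A) (select-left ρζ))))) (sym ρζ))

  -- Termination: every component leaves `Q`.

  bound : ℕ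
  bound = size (Q ⊕ R) ^ size P

  code : Hom P (Q ⊕ R) → Fin bound
  code η = funToFin λ i → Inverse.from (enum (Q ⊕ R)) (fun η (Inverse.to (enum P) i))

  code-injective : ∀ {η θ} → code η ≡ code θ → η ≗H θ
  code-injective {η} {θ} eq x =
    trans (sym (decode-code η)) (trans (cong decode eq) (decode-code θ))
    where
    decode : Fin bound → Carrier (Q ⊕ R)
    decode c = Inverse.to (enum (Q ⊕ R)) (finToFun c (Inverse.from (enum P) x))
    decode-code : ∀ η → decode (code η) ≡ fun η x
    decode-code η = trans
      (cong (Inverse.to (enum (Q ⊕ R))) (finToFun-funToFin _ (Inverse.from (enum P) x)))
      (trans (Inverse.strictlyInverseˡ (enum (Q ⊕ R)) _)
             (cong (fun η) (Inverse.strictlyInverseˡ (enum P) x)))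

  -- Two of the `bound + 1` orbit maps at stages 0 to `bound` coincide, say at `i < j`. A point
  -- active at `bound` is active at both, and backtracking `ξ` against itself on `Active ξ j` would
  -- force `i = j`.
  inactive : ∀ ξ x → ¬ Active ξ bound x
  inactive ξ x act with pigeonhole (ℕ.n<1+n bound) (λ i → code (orbit ξ (toℕ i)))
  ... | i , j , i<j , eq = ℕ.<⇒≢ i<j (proj₁
    (backtrack (active? ξ (toℕ j)) (active-clopen ξ (toℕ j)) ξ ξ (toℕ i) (toℕ j)
      (active-anti ξ (ℕ.<⇒≤ i<j)) id
      (λ {z} _ → code-injective {orbit ξ (toℕ i)} {orbit ξ (toℕ j)} eq z)
      (active-anti ξ (toℕ≤pred[n] j) act)))

  -- The limit map into `S` and its injectivity.

  settled : ∀ ξ k {x} → ¬ Active ξ k x → ¬ inQ ξ k x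
  settled ξ k ¬a l = ¬a (active-pred ξ k l)

  result-value : ∀ ξ x → ∃[ s ] value ξ bound x ≡ inj₂ s
  result-value ξ x = ¬left⇒inj₂ (settled ξ bound (inactive ξ x))

  result : Hom P R → Hom P S
  result ξ = mkHom (proj₁ ∘ result-value ξ) λ {x} {y} x≤y →
    inj₂-reflects-≤ (proj₂ (result-value ξ x)) (proj₂ (result-value ξ y))
      (mono (ρ (orbit ξ bound)) x≤y)

  value-stable : ∀ ξ k m {x} → ¬ inQ ξ k x → value ξ (m + k) x ≡ value ξ k x
  value-stable ξ k zero    ¬q = refl
  value-stable ξ k (suc m) {x} ¬q =
    trans (value-frozen ξ (m + k) λ q → ¬q (subst Left eq q)) eq
    where eq = value-stable ξ k m {x} ¬q

  -- `bound` depends on the poset; the surplus `m` lets results over two posets be read off at a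
  -- common stage.
  value≡result : ∀ ξ m x → value ξ (m + bound) x ≡ inj₂ (fun (result ξ) x)
  value≡result ξ m x =
    trans (value-stable ξ bound m (settled ξ bound (inactive ξ x))) (proj₂ (result-value ξ x))

  result-cong : ∀ {ξ ζ} → ξ ≗H ζ → result ξ ≗H result ζ
  result-cong {ξ} {ζ} ξ≗ζ x = inj₂-injective (trans (sym (proj₂ (result-value ξ x)))
    (trans (ρ-cong′ (orbit ξ bound) (orbit ζ bound) (orbit-cong bound) x)
           (proj₂ (result-value ζ x))))
    where
    ρ-cong′ : ∀ η θ → η ≗H θ → ρ η ≗H ρ θ
    ρ-cong′ η θ η≗θ x = local (full-clopen {P}) {η} {θ} (λ {z} _ → η≗θ z) tt
    orbit-cong : ∀ k → orbit ξ k ≗H orbit ζ k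
    orbit-cong zero    x = cong inj₂ (ξ≗ζ x)
    orbit-cong (suc k) x
      rewrite ρ-cong′ (orbit ξ k) (orbit ζ k) (orbit-cong k) x | orbit-cong k x = refl

  -- The points whose first value in `S` occurs at stage `k`.
  ExitsAt : Hom P R → ℕ → Pred (Carrier P) 0ℓ
  ExitsAt ξ k = Active ξ k ∩ ∁ (inQ ξ k)

  exitsAt? : ∀ ξ k → Decidable (ExitsAt ξ k)
  exitsAt? ξ k x = active? ξ k x ×-dec ¬? (left? (value ξ k x))

  exitsAt-clopen : ∀ ξ k → Clopen P (ExitsAt ξ k)
  exitsAt-clopen ξ k =
    ∩-clopen {P} (active-clopen ξ k) (∁-clopen {P} (inQ-clopen ξ k))

  exits : ∀ ξ x → ∃[ k ] (ExitsAt ξ k x)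
  exits ξ x = search bound (inactive ξ x)
    where
    search : ∀ k → ¬ Active ξ k x → ∃[ k ] (ExitsAt ξ k x)
    search zero    ¬a = contradiction tt ¬a
    search (suc k) ¬a with active? ξ k x
    ... | yes a  = k , a , ¬a
    ... | no ¬a′ = search k ¬a′

  value-at-exit : ∀ ξ k {x} → ExitsAt ξ k x → value ξ k x ≡ inj₂ (fun (result ξ) x)
  value-at-exit ξ k {x} (_ , ¬q) = begin
    value ξ k x            ≡⟨ value-stable ξ k bound ¬q ⟨
    value ξ (bound + k) x  ≡⟨ cong (λ n → value ξ n x) (ℕ.+-comm bound k) ⟩
    value ξ (k + bound) x  ≡⟨ value≡result ξ k x ⟩
    inj₂ (fun (result ξ) x) ∎
    where open ≡-Reasoning

  -- Exit stages vary between components, so the argument is made around each point: on the clopen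
  -- set of points sharing the exit stages `a` and `b`, the exit values agree with the results.
  -- Local injectivity removes the last `ρ`, and `backtrack` undoes the remaining steps.
  result-injective : ∀ {ξ ζ} → result ξ ≗H result ζ → ξ ≗H ζ
  result-injective {ξ} {ζ} eq x with exits ξ x | exits ζ x
  ... | a , ea | b , eb = proj₂
    (backtrack A? cA ξ ζ a b (proj₁ ∘ proj₁) (proj₁ ∘ proj₂)
      (locally-injective A? cA {orbit ξ a} {orbit ζ b} values) (ea , eb))
    where
    A = ExitsAt ξ a ∩ ExitsAt ζ b
    A? : Decidable A
    A? z = exitsAt? ξ a z ×-dec exitsAt? ζ b z
    cA : Clopen P A
    cA = ∩-clopen {P} (exitsAt-clopen ξ a) (exitsAt-clopen ζ b)
    values : ∀ {z} → A z → value ξ a z ≡ value ζ b z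
    values {z} (za , zb) =
      trans (value-at-exit ξ a za) (trans (cong inj₂ (eq z)) (sym (value-at-exit ζ b zb)))

  -- Matchings between successive stages of the iteration.

  embed-match : ∀ ξ x → MatchNear inj₂-matching (embed ξ) ξ x
  embed-match ξ x = match-everywhere inj₂-matching λ _ → refl

  result-match : ∀ ξ m x → MatchNear inj₂-matching (ρ (orbit ξ (m + bound))) (result ξ) x
  result-match ξ m x = match-everywhere inj₂-matching (value≡result ξ m)

  advance-match : ∀ ξ k {x} → inQ ξ k x →
    MatchNear inj₁-matching (ρ (orbit ξ k)) (orbit ξ (suc k)) x
  advance-match ξ k q = record
    { near = inQ ξ k ; clopen = inQ-clopen ξ k ; here = q
    ; match = λ (q , eq) → q , eq , select-left eq }

  frozen-match : ∀ ξ k {x} → ¬ inQ ξ k x →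
    MatchNear ≡-matching (orbit ξ k) (orbit ξ (suc k)) x
  frozen-match ξ k ¬q = record
    { near = ∁ (inQ ξ k) ; clopen = ∁-clopen {P} (inQ-clopen ξ k) ; here = ¬q
    ; match = λ ¬q → sym (frozen ξ k ¬q) }

-- From the given I-scheme to the cancelled one.

module Cancellation {Ix : Set} (Rep : Ix → FPoset) (Q R S : FPoset)
  (σ : HomScheme Rep (Q ⊕ R) (Q ⊕ S))
  (strong : IsStrong Rep σ) (I-scheme : IsIScheme Rep σ) where

  preserves : ∀ κ {i j} (ξ : Hom (Rep i) (Q ⊕ R)) (ζ : Hom (Rep j) (Q ⊕ R)) {x y} →
    α ξ x ≤⟨ κ ⟩ α ζ y → α (ρ σ i ξ) x ≤⟨ κ ⟩ α (ρ σ j ζ) y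
  preserves strict ξ ζ = proj₂ (I-scheme _ _ ξ ζ _ _)
  preserves weak   ξ ζ = proj₁ (I-scheme _ _ ξ ζ _ _)

  local : ∀ i {A} → Clopen (Rep i) A → ∀ {η θ} → (∀ {x} → A x → fun η x ≡ fun θ x) →
          ∀ {x} → A x → fun (ρ σ i η) x ≡ fun (ρ σ i θ) x
  local i {A} cA {η} {θ} eq {x} x∈A = ≤-antisym (Q ⊕ S)
    (≤₊⇒≤ {ξ = ρ σ i η} {ρ σ i θ} (preserves weak η θ (inj₂ η≡θ)))
    (≤₊⇒≤ {ξ = ρ σ i θ} {ρ σ i η} (preserves weak θ η (inj₂ (≡EV-sym {b = α θ x} η≡θ))))
    where
    η~θ : MatchNear ≡-matching η θ x
    η~θ = record { near = A ; clopen = cA ; here = x∈A ; match = eq }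
    η≡θ : α η x ≡EV α θ x
    -- Reflexivity at `η`, with only the right-hand side moved to `θ`.
    η≡θ = ≡EV-match (match-everywhere ≡-matching {h = η} {η} {x} λ _ → refl) η~θ
            (refl , (id , id) , (id , id))

  module It i = Iteration (Rep i) Q R S (ρ σ i) (local i) (strong i)

  module _ (κ : Kind) {i j : Ix} (ξ : Hom (Rep i) R) (ζ : Hom (Rep j) R)
           {x : Carrier (Rep i)} {y : Carrier (Rep j)} where

    -- Both points do the same thing at stage `k`: either both advance, and the relation is taken
    -- over from the images under `ρ`, or both are frozen, and the old relation persists.
    orbit-step : ∀ k → α (It.orbit i ξ k) x ≤⟨ κ ⟩ α (It.orbit j ζ k) y →
      α (It.orbit i ξ (suc k)) x ≤⟨ κ ⟩ α (It.orbit j ζ (suc k)) y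
    orbit-step k p = go (left? (It.value i ξ k x))
      where
      ξₖ = It.orbit i ξ k
      ζₖ = It.orbit j ζ k
      ρp = preserves κ ξₖ ζₖ p
      -- Related triples have comparable first entries, which therefore lie in the same summand of
      -- `Q ⊕ S`.
      same-side = left-clopen (≤₊⇒≤ {ξ = ρ σ i ξₖ} {ρ σ j ζₖ} (≤⟨⟩⇒≤₊ κ ρp))
      go : Dec (It.inQ i ξ k x) →
        α (It.orbit i ξ (suc k)) x ≤⟨ κ ⟩ α (It.orbit j ζ (suc k)) y
      go (yes l) = ≤⟨⟩-match (It.advance-match i ξ k l)
                             (It.advance-match j ζ k (proj₁ same-side l)) κ ρp
      go (no ¬l) = ≤⟨⟩-match (It.frozen-match i ξ k ¬l)
                             (It.frozen-match j ζ k (¬l ∘ proj₂ same-side)) κ p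

    orbit-preserves : ∀ k → α ξ x ≤⟨ κ ⟩ α ζ y → α (It.orbit i ξ k) x ≤⟨ κ ⟩ α (It.orbit j ζ k) y
    orbit-preserves zero    = ≤⟨⟩-match (matchNear-converse (It.embed-match i ξ x))
                                        (matchNear-converse (It.embed-match j ζ y)) κ
    orbit-preserves (suc k) p = orbit-step k (orbit-preserves k p)

    result-preserves : α ξ x ≤⟨ κ ⟩ α ζ y → α (It.result i ξ) x ≤⟨ κ ⟩ α (It.result j ζ) y
    result-preserves p = ≤⟨⟩-match (It.result-match i ξ (It.bound j) x) ζ-match κ
      (preserves κ (It.orbit i ξ n) (It.orbit j ζ n) (orbit-preserves n p))
      where
      -- A stage beyond the bounds of both posets. It has the form `m + bound` for `i` as it stands,
      -- and for `j` after commuting the sum.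
      n = It.bound j + It.bound i
      ζ-match : MatchNear inj₂-matching (ρ σ j (It.orbit j ζ n)) (It.result j ζ) y
      ζ-match = subst (λ n → MatchNear inj₂-matching (ρ σ j (It.orbit j ζ n)) (It.result j ζ) y)
        (ℕ.+-comm (It.bound i) (It.bound j)) (It.result-match j ζ (It.bound i) y)

  scheme : HomScheme Rep R S
  scheme = record { ρ = It.result ; ρ-cong = λ i {ξ} {ζ} → It.result-cong i {ξ} {ζ} }

theorem4 : {Ix : Set} (Rep : Ix → FPoset) → IsRepSystem Rep →
    (Q R S : FPoset) → _⊑I_ Rep (Q ⊕ R) (Q ⊕ S) → _⊑I_ Rep R S
theorem4 Rep _ Q R S (σ , strong , I-scheme) =
  scheme ,
  (λ i {ξ} {ζ} → It.result-injective i {ξ} {ζ}) ,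
  (λ i j ξ ζ x y → result-preserves weak ξ ζ , result-preserves strict ξ ζ)
  where open Cancellation Rep Q R S σ strong I-scheme
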